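{- For all integers $n\ge 0$, $$\mathrm{cp}_{1,1,1}(n)=\sum_{k=0}^n p(k).$$
   Context: A partition of a non-negative integer $n$ is a finite multiset of positive integers (its parts) with sum $n$; the empty multiset is the unique partition of $0$. $p(n)$ is the number of partitions of $n$, so $p(0)=1$. The size $|\lambda|$ of a partition is the sum of its parts. A $(1,1,1)$-copartition is a triple of partitions $(\gamma,\rho,\sigma)$, with $\gamma$ and $\sigma$ arbitrary (possibly empty) partitions, such that $\rho$ has the same number of parts as $\sigma$, each of which has size equal to the number of parts of $\gamma$ (if $\gamma$ is empty, $\rho$ is regarded as empty). Its size is $|\gamma|+|\rho|+|\sigma|$, and $\mathrm{cp}_{1,1,1}(n)$ is the number of $(1,1,1)$-copartitions of size $n$. -}

module Defs where

open import Data.Nat using (ℕ; zero; suc; _+_; _≤_; _≥_; _<_; s≤s⁻¹)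
open import Data.Nat.ListAction using (sum)
open import Data.Nat.Properties
  using (_≟_; _≥?_; _<?_; ≤-reflexive; ≤-trans; m≤m+n; m≤n+m; suc-injective)
open import Data.List
  using (List; []; _∷_; length; map; upTo; filter; cartesianProduct; cartesianProductWith)
open import Data.List.Properties using (≡-dec; ∷-injective)
open import Data.List.Relation.Unary.All using (All; []; _∷_; all?)
open import Data.List.Relation.Unary.AllPairs using ([]; _∷_)
open import Data.List.Relation.Unary.Any using (here; there)
open import Data.List.Relation.Unary.Linked using (Linked; linked?)
open import Data.List.Relation.Unary.Unique.Propositional using (Unique)
import Data.List.Relation.Unary.Unique.Propositional.Properties as Unique
import Data.List.Relation.Unary.All as All
open import Data.List.Membership.Propositional using (_∈_)
open import Data.List.Membership.Propositional.Properties
  using (∈-filter⁺; ∈-filter⁻; ∈-map⁺; ∈-upTo⁺; ∈-cartesianProduct⁺; ∈-cartesianProductWith⁺;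
         ∈-cartesianProductWith⁻)
open import Data.Product using (_×_; _,_; proj₂)
open import Relation.Nullary using (Dec)
open import Relation.Nullary.Decidable using (_×-dec_; map′)
open import Relation.Unary using (Decidable)
open import Relation.Binary.PropositionalEquality using (_≡_; _≢_; refl)

-- A multiset of positive integers is represented by its unique weakly
-- decreasing list of elements.

record IsPartition (parts : List ℕ) : Set where
  constructor isPartition
  field
    decreasing : Linked _≥_ parts
    positive   : All (0 <_) parts

record IsPartitionOf (n : ℕ) (parts : List ℕ) : Set where
  constructor isPartitionOf
  field
    partition : IsPartition parts
    size      : sum parts ≡ n

RhoCondition : (γ ρ σ : List ℕ) → Set
RhoCondition []        ρ σ = ρ ≡ []
RhoCondition γ@(_ ∷ _) ρ σ = length ρ ≡ length σ × All (_≡ length γ) ρ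

record IsCopartition (γ ρ σ : List ℕ) : Set where
  constructor isCopartition
  field
    γ-partition : IsPartition γ
    ρ-partition : IsPartition ρ
    σ-partition : IsPartition σ
    ρ-condition : RhoCondition γ ρ σ

IsCopartitionOf : ℕ → List ℕ × List ℕ × List ℕ → Set
IsCopartitionOf n (γ , ρ , σ) = IsCopartition γ ρ σ × sum γ + sum ρ + sum σ ≡ n

-- A repetition-free list of exactly the elements satisfying P.  The value of
-- count depends only on P, not on the enumeration chosen.

record Enumeration {A : Set} (P : A → Set) : Set where
  field
    elements : List A
    unique   : Unique elements
    sound    : ∀ {x} → x ∈ elements → P x
    complete : ∀ {x} → P x → x ∈ elements

  count : ℕ
  count = length elements

open Enumeration public using (count)

enumerateWithin : {A : Set} {P : A → Set} → Decidable P →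
                  (xs : List A) → Unique xs → (∀ {x} → P x → x ∈ xs) → Enumeration P
enumerateWithin P? xs xs! P⊆xs = record
  { elements = filter P? xs
  ; unique   = Unique.filter⁺ P? xs!
  ; sound    = λ x∈ → proj₂ (∈-filter⁻ P? {xs = xs} x∈)
  ; complete = λ Px → ∈-filter⁺ P? (P⊆xs Px) Px
  }

isPartition? : Decidable IsPartition
isPartition? l = map′ (λ (d , p) → isPartition d p) (λ (isPartition d p) → d , p)
  (linked? _≥?_ l ×-dec all? (0 <?_) l)

isPartitionOf? : ∀ n → Decidable (IsPartitionOf n)
isPartitionOf? n l = map′ (λ (p , s) → isPartitionOf p s) (λ (isPartitionOf p s) → p , s)
  (isPartition? l ×-dec (sum l ≟ n))

rhoCondition? : ∀ γ ρ σ → Dec (RhoCondition γ ρ σ)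
rhoCondition? []        ρ σ = ≡-dec _≟_ ρ []
rhoCondition? γ@(_ ∷ _) ρ σ = (length ρ ≟ length σ) ×-dec all? (_≟ length γ) ρ

isCopartition? : ∀ γ ρ σ → Dec (IsCopartition γ ρ σ)
isCopartition? γ ρ σ =
  map′ (λ (a , b , c , d) → isCopartition a b c d) (λ (isCopartition a b c d) → a , b , c , d)
  (isPartition? γ ×-dec isPartition? ρ ×-dec isPartition? σ ×-dec rhoCondition? γ ρ σ)

isCopartitionOf? : ∀ n → Decidable (IsCopartitionOf n)
isCopartitionOf? n (γ , ρ , σ) = isCopartition? γ ρ σ ×-dec (sum γ + sum ρ + sum σ ≟ n)

-- All lists of length at most l with entries in {1, …, n}.

words : (l n : ℕ) → List (List ℕ)
words zero    n = [] ∷ []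
words (suc l) n = [] ∷ cartesianProductWith _∷_ (map suc (upTo n)) (words l n)

words-unique : ∀ l n → Unique (words l n)
words-unique zero    n = [] ∷ []
words-unique (suc l) n =
  All.tabulate nonempty
  ∷ Unique.cartesianProductWith⁺ _∷_ ∷-injective
      (Unique.map⁺ suc-injective (Unique.upTo⁺ n)) (words-unique l n)
  where
  nonempty : ∀ {w} → w ∈ cartesianProductWith _∷_ (map suc (upTo n)) (words l n) → [] ≢ w
  nonempty w∈ refl with ∈-cartesianProductWith⁻ _∷_ (map suc (upTo n)) (words l n) w∈
  ... | _ , _ , _ , _ , ()

∈-words : ∀ l n {w} → All (0 <_) w → sum w ≤ l → sum w ≤ n → w ∈ words l n
∈-words zero    n {[]}        _        _  _  = here refl
∈-words (suc l) n {[]}        _        _  _  = here refl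
∈-words zero    n {zero ∷ _}  (() ∷ _) _  _
∈-words zero    n {suc _ ∷ _} _        () _
∈-words (suc l) n {suc x ∷ w} (_ ∷ ps) sl sn =
  there (∈-cartesianProductWith⁺ _∷_
    (∈-map⁺ suc (∈-upTo⁺ (≤-trans (m≤m+n (suc x) (sum w)) sn)))
    (∈-words l n ps (≤-trans (m≤n+m (sum w) x) (s≤s⁻¹ sl)) (≤-trans (m≤n+m (sum w) (suc x)) sn)))

partitions : ∀ n → Enumeration (IsPartitionOf n)
partitions n = enumerateWithin (isPartitionOf? n) (words n n) (words-unique n n)
  λ (isPartitionOf (isPartition _ ps) s) → ∈-words n n ps (≤-reflexive s) (≤-reflexive s)

copartitions : ∀ n → Enumeration (IsCopartitionOf n)
copartitions n = enumerateWithin (isCopartitionOf? n)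
  (cartesianProduct W (cartesianProduct W W))
  (Unique.cartesianProduct⁺ W! (Unique.cartesianProduct⁺ W! W!))
  λ {t} → within t
  where
  W  = words n n
  W! = words-unique n n
  within : ∀ t → IsCopartitionOf n t → t ∈ cartesianProduct W (cartesianProduct W W)
  within (γ , ρ , σ) (isCopartition γp ρp σp _ , s) =
    ∈-cartesianProduct⁺ (∈W γp γ≤n) (∈-cartesianProduct⁺ (∈W ρp ρ≤n) (∈W σp σ≤n))
    where
    ∈W : ∀ {w} → IsPartition w → sum w ≤ n → w ∈ W
    ∈W p w≤n = ∈-words n n (IsPartition.positive p) w≤n w≤n
    γρ≤n : sum γ + sum ρ ≤ n
    γρ≤n = ≤-trans (m≤m+n _ (sum σ)) (≤-reflexive s)
    γ≤n : sum γ ≤ n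
    γ≤n = ≤-trans (m≤m+n _ (sum ρ)) γρ≤n
    ρ≤n : sum ρ ≤ n
    ρ≤n = ≤-trans (m≤n+m _ (sum γ)) γρ≤n
    σ≤n : sum σ ≤ n
    σ≤n = ≤-trans (m≤n+m _ (sum γ + sum ρ)) (≤-reflexive s)

p : ℕ → ℕ
p n = count (partitions n)

cp₁₁₁ : ℕ → ℕ
cp₁₁₁ n = count (copartitions n)

{-# OPTIONS --safe #-}
module Submission where

-- The identity is proved by a bijection between the copartitions of n and the
-- partitions of size at most n.  Given a copartition (γ , ρ , σ), let m be the
-- number of parts of γ.  The partition ρ is determined by γ and σ, and its size
-- is m times the number of parts of σ.  So adding m to each part of σ absorbs ρ
-- and gives an arbitrary partition with parts greater than m.  If m > 0, the
-- conjugate of γ has largest part m, and deleting one part m leaves an arbitrary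
-- partition with parts at most m; if m = 0, both γ and its conjugate are empty.
-- The two partitions together form one partition of n ∸ m, the merge of γ and σ.
--
-- Conversely, a partition μ of size at most n determines m as n ∸ sum μ; its
-- parts greater than m give σ after subtracting m from each, and its parts at
-- most m, with an additional part m, are conjugated to give γ.  The maps are
-- mutually inverse by splitγ-merge, splitσ-merge and merge-split, which use
-- that conjugation is an involution (conj-involutive), and the sizes match by
-- sum-copartition.
--
-- Finite counts are compared through count-cong: mutually inverse maps between
-- two enumerated predicates make the enumerations equinumerous.

open import Defs
open import Data.Nat
  using (ℕ; zero; suc; _+_; _*_; _∸_; _⊔_; _≤_; _<_; _≥_; z≤n; s≤s; s≤s⁻¹)
open import Data.Nat.ListAction using (sum)
open import Data.Nat.ListAction.Properties using (sum-++)
open import Data.Nat.Properties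
open import Data.Nat.Solver using (module +-*-Solver)
open import Data.List
  using (List; []; _∷_; _++_; map; upTo; length; drop; filter; replicate; concatMap)
open import Data.List.Properties
  using (length-++; length-map; map-∘; map-id-local; length-replicate;
         filter-++; filter-all; filter-none; filter-accept; filter-reject; ++-identityʳ)
open import Data.List.Membership.Propositional using (_∈_; find; lose)
open import Data.List.Membership.Propositional.Properties
  using (∈-map⁺; ∈-map⁻; ∈-upTo⁺; ∈-upTo⁻; ∈-concatMap⁺; ∈-concatMap⁻)
open import Data.List.Membership.Propositional.Properties.WithK using (unique∧set⇒bag)
open import Data.List.Relation.Binary.BagAndSetEquality using (∼bag⇒↭)
open import Data.List.Relation.Binary.Permutation.Propositional.Properties using (↭-length)
open import Data.List.Relation.Unary.All as All using (All; []; _∷_)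
import Data.List.Relation.Unary.All.Properties as All
open import Data.List.Relation.Unary.AllPairs as AllPairs using (AllPairs; []; _∷_)
import Data.List.Relation.Unary.AllPairs.Properties as AllPairs
open import Data.List.Relation.Unary.Linked.Properties using (Linked⇒AllPairs; AllPairs⇒Linked)
open import Data.List.Relation.Unary.Unique.Propositional using (Unique)
import Data.List.Relation.Unary.Unique.Propositional.Properties as Unique
open import Data.Product using (_×_; _,_; ∃-syntax)
open import Function using (_∘_; _∘′_)
open import Function.Bundles using (mk⇔)
open import Relation.Binary.PropositionalEquality
  using (_≡_; refl; sym; trans; cong; cong₂; subst; module ≡-Reasoning)
open import Relation.Nullary using (yes; no)

-- Counting by bijections

module _ {A B : Set} {P : A → Set} {Q : B → Set} where

  count-cong : (E : Enumeration P) (F : Enumeration Q) (f : A → B) (g : B → A) →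
               (∀ {x} → P x → Q (f x)) → (∀ {y} → Q y → P (g y)) →
               (∀ {x} → P x → g (f x) ≡ x) → (∀ {y} → Q y → f (g y) ≡ y) →
               count E ≡ count F
  count-cong E F f g f-Q g-P gf fg = begin
    length xs         ≡⟨ length-map f xs ⟨
    length (map f xs) ≡⟨ ↭-length (∼bag⇒↭ (unique∧set⇒bag fxs! F.unique (mk⇔ to from))) ⟩
    length ys         ∎
    where
    open ≡-Reasoning
    module E = Enumeration E
    module F = Enumeration F
    xs = E.elements
    ys = F.elements
    -- f need only be injective on P, so uniqueness is read off from
    -- map g (map f xs) ≡ xs.
    gfxs : xs ≡ map g (map f xs)
    gfxs = trans (sym (map-id-local (All.tabulate (gf ∘′ E.sound)))) (map-∘ xs)
    fxs! : Unique (map f xs)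
    fxs! = Unique.map⁻ (subst Unique gfxs E.unique)
    to : ∀ {y} → y ∈ map f xs → y ∈ ys
    to y∈ with ∈-map⁻ f y∈
    ... | x , x∈ , refl = F.complete (f-Q (E.sound x∈))
    from : ∀ {y} → y ∈ ys → y ∈ map f xs
    from y∈ = subst (_∈ map f xs) (fg (F.sound y∈)) (∈-map⁺ f (E.complete (g-P (F.sound y∈))))

length-concatMap : {A B : Set} (f : A → List B) (xs : List A) →
                   length (concatMap f xs) ≡ sum (map (length ∘ f) xs)
length-concatMap f []       = refl
length-concatMap f (x ∷ xs) = trans (length-++ (f x)) (cong (length (f x) +_) (length-concatMap f xs))

-- The union of the first n + 1 members of a disjoint family of predicates.
module _ {A : Set} {P : ℕ → A → Set} (disjoint : ∀ {k l x} → P k x → P l x → k ≡ l)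
         (E : ∀ k → Enumeration (P k)) where

  enumerateUpTo : ∀ n → Enumeration (λ x → ∃[ k ] k ≤ n × P k x)
  enumerateUpTo n = record
    { elements = concatMap elements-of (upTo (suc n))
    ; unique   = Unique.concat⁺ {xss = map elements-of (upTo (suc n))}
        (All.map⁺ {f = elements-of} (All.tabulate λ {k} _ → Enumeration.unique (E k)))
        (AllPairs.map⁺ {f = elements-of} (AllPairs.map
          (λ k≢l {_} (x∈k , x∈l) → k≢l (disjoint (Enumeration.sound (E _) x∈k)
                                                 (Enumeration.sound (E _) x∈l)))
          (Unique.upTo⁺ (suc n))))
    ; sound    = sound
    ; complete = λ { {x} (k , k≤n , Px) → ∈-concatMap⁺ elements-of
        (lose {P = λ l → x ∈ elements-of l} (∈-upTo⁺ (s≤s k≤n)) (Enumeration.complete (E k) Px)) }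
    }
    where
    elements-of : ℕ → List A
    elements-of k = Enumeration.elements (E k)
    sound : ∀ {x} → x ∈ concatMap elements-of (upTo (suc n)) → ∃[ k ] k ≤ n × P k x
    sound x∈ with find (∈-concatMap⁻ elements-of {upTo (suc n)} x∈)
    ... | k , k∈ , x∈k = k , s≤s⁻¹ (∈-upTo⁻ k∈) , Enumeration.sound (E k) x∈k

  count-enumerateUpTo : ∀ n → count (enumerateUpTo n) ≡ sum (map (λ k → count (E k)) (upTo (suc n)))
  count-enumerateUpTo n = length-concatMap (λ k → Enumeration.elements (E k)) (upTo (suc n))

-- Partitions of size at most n.
IsPartitionUpTo : ℕ → List ℕ → Set
IsPartitionUpTo n μ = ∃[ k ] k ≤ n × IsPartitionOf k μ

size-unique : ∀ {k l μ} → IsPartitionOf k μ → IsPartitionOf l μ → k ≡ l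
size-unique (isPartitionOf _ refl) (isPartitionOf _ refl) = refl

-- Conjugation

-- Weakly decreasing lists, with all pairs of entries compared.
Decreasing : List ℕ → Set
Decreasing = AllPairs _≥_

decreasing : ∀ {xs} → IsPartition xs → Decreasing xs
decreasing (isPartition d _) = Linked⇒AllPairs (λ x≥y y≥z → ≤-trans y≥z x≥y) d

mkPartition : ∀ {xs} → Decreasing xs → All (0 <_) xs → IsPartition xs
mkPartition d = isPartition (AllPairs⇒Linked d)

-- Adds 1 to each of the first k entries of a list, which is regarded as
-- continued by zeros: in terms of Young diagrams, a new column of height k is
-- put in front of the rows xs.
bump : ℕ → List ℕ → List ℕ
bump zero    xs       = xs
bump (suc k) []       = 1 ∷ bump k []
bump (suc k) (x ∷ xs) = suc x ∷ bump k xs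

-- The conjugate partition: each part of the argument becomes a column.  The
-- definition makes sense for every list and ignores zeros.
conj : List ℕ → List ℕ
conj []       = []
conj (x ∷ xs) = bump x (conj xs)

bump-positive : ∀ k {xs} → All (0 <_) xs → All (0 <_) (bump k xs)
bump-positive zero    ps       = ps
bump-positive (suc k) []       = s≤s z≤n ∷ bump-positive k []
bump-positive (suc k) (p ∷ ps) = s≤s z≤n ∷ bump-positive k ps

bump-≤ : ∀ k {b xs} → All (_≤ b) xs → All (_≤ suc b) (bump k xs)
bump-≤ zero    ps       = All.map m≤n⇒m≤1+n ps
bump-≤ (suc k) []       = s≤s z≤n ∷ bump-≤ k []
bump-≤ (suc k) (p ∷ ps) = s≤s p ∷ bump-≤ k ps

bump-decreasing : ∀ k {xs} → Decreasing xs → Decreasing (bump k xs)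
bump-decreasing zero    ds       = ds
bump-decreasing (suc k) []       = bump-≤ k [] ∷ bump-decreasing k []
bump-decreasing (suc k) (d ∷ ds) = bump-≤ k d ∷ bump-decreasing k ds

length-bump : ∀ k xs → length (bump k xs) ≡ k ⊔ length xs
length-bump zero    xs       = refl
length-bump (suc k) []       = cong suc (trans (length-bump k []) (⊔-identityʳ k))
length-bump (suc k) (x ∷ xs) = cong suc (length-bump k xs)

sum-bump : ∀ k xs → sum (bump k xs) ≡ k + sum xs
sum-bump zero    xs       = refl
sum-bump (suc k) []       = cong suc (sum-bump k [])
sum-bump (suc k) (x ∷ xs) = cong suc (trans (cong (x +_) (sum-bump k xs))
  (solve 3 (λ x k s → x :+ (k :+ s) := k :+ (x :+ s)) refl x k (sum xs)))
  where open +-*-Solver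

conj-positive : ∀ xs → All (0 <_) (conj xs)
conj-positive []       = []
conj-positive (x ∷ xs) = bump-positive x (conj-positive xs)

conj-decreasing : ∀ xs → Decreasing (conj xs)
conj-decreasing []       = []
conj-decreasing (x ∷ xs) = bump-decreasing x (conj-decreasing xs)

conj-partition : ∀ xs → IsPartition (conj xs)
conj-partition xs = mkPartition (conj-decreasing xs) (conj-positive xs)

conj-≤-length : ∀ xs → All (_≤ length xs) (conj xs)
conj-≤-length []       = []
conj-≤-length (x ∷ xs) = bump-≤ x (conj-≤-length xs)

sum-conj : ∀ xs → sum (conj xs) ≡ sum xs
sum-conj []       = refl
sum-conj (x ∷ xs) = trans (sum-bump x (conj xs)) (cong (x +_) (sum-conj xs))

length-conj-≤ : ∀ {b xs} → All (_≤ b) xs → length (conj xs) ≤ b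
length-conj-≤ []                       = z≤n
length-conj-≤ {xs = x ∷ xs} (x≤b ∷ xs≤b) =
  ≤-trans (≤-reflexive (length-bump x (conj xs))) (⊔-lub x≤b (length-conj-≤ xs≤b))

length-conj : ∀ {x xs} → All (_≤ x) xs → length (conj (x ∷ xs)) ≡ x
length-conj {x} {xs} xs≤x = trans (length-bump x (conj xs)) (m≥n⇒m⊔n≡m (length-conj-≤ xs≤x))

-- A new first column at least as high as the diagram becomes a new first row of
-- the conjugate.  A column of height 0 would break this: it is not recorded.
conj-bump : ∀ k xs → length xs ≤ suc k → conj (bump (suc k) xs) ≡ suc k ∷ conj xs
conj-bump zero    []       _           = refl
conj-bump zero    (x ∷ []) _           = refl
conj-bump zero    (x ∷ _ ∷ _) (s≤s ())
conj-bump (suc k) []       _           = cong (bump 1) (conj-bump k [] z≤n)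
conj-bump (suc k) (x ∷ xs) (s≤s l)     = cong (bump (suc x)) (conj-bump k xs l)

conj-involutive : ∀ {xs} → Decreasing xs → All (0 <_) xs → conj (conj xs) ≡ xs
conj-involutive []       []                         = refl
conj-involutive {suc x ∷ xs} (d ∷ ds) (_ ∷ ps) =
  trans (conj-bump x (conj xs) (length-conj-≤ d)) (cong (suc x ∷_) (conj-involutive ds ps))

-- The conjugate of γ with its largest part removed.
conjTail : List ℕ → List ℕ
conjTail γ = drop 1 (conj γ)

-- For positive parts, the first column of γ has height length γ.
conj-∷ : ∀ {x xs} → All (0 <_) (x ∷ xs) →
         conj (x ∷ xs) ≡ length (x ∷ xs) ∷ conjTail (x ∷ xs)
conj-∷ {suc x} {[]}     _        = refl
conj-∷ {zero}           (() ∷ _)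
conj-∷ {suc x} {y ∷ ys} (_ ∷ ps) = bump-head (conj-∷ ps)
  where
  bump-head : ∀ {zs l t} → zs ≡ l ∷ t → bump (suc x) zs ≡ suc l ∷ drop 1 (bump (suc x) zs)
  bump-head refl = refl

sum-conjTail : ∀ {γ} → All (0 <_) γ → sum γ ≡ length γ + sum (conjTail γ)
sum-conjTail {[]}    _  = refl
sum-conjTail {x ∷ γ} ps = trans (sym (sum-conj (x ∷ γ))) (cong sum (conj-∷ ps))

-- Rectangles

-- The only ρ that completes γ and σ to a copartition: a rectangle with
-- length σ rows of size length γ, and no rows at all (instead of rows of size 0)
-- when γ is empty.
rho : List ℕ → List ℕ → List ℕ
rho []        σ = []
rho γ@(_ ∷ _) σ = replicate (length σ) (length γ)

replicate-decreasing : ∀ k x → Decreasing (replicate k x)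
replicate-decreasing zero    x = []
replicate-decreasing (suc k) x = All.replicate⁺ k ≤-refl ∷ replicate-decreasing k x

rho-partition : ∀ γ σ → IsPartition (rho γ σ)
rho-partition []        σ = mkPartition [] []
rho-partition γ@(_ ∷ _) σ =
  mkPartition (replicate-decreasing (length σ) (length γ)) (All.replicate⁺ (length σ) (s≤s z≤n))

rho-condition : ∀ γ σ → RhoCondition γ (rho γ σ) σ
rho-condition []        σ = refl
rho-condition γ@(_ ∷ _) σ = length-replicate (length σ) , All.replicate⁺ (length σ) refl

all-≡⇒replicate : ∀ {x : ℕ} {xs} → All (_≡ x) xs → xs ≡ replicate (length xs) x
all-≡⇒replicate []          = refl
all-≡⇒replicate (refl ∷ ps) = cong (_ ∷_) (all-≡⇒replicate ps)

rho-unique : ∀ γ {ρ} σ → RhoCondition γ ρ σ → rho γ σ ≡ ρ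
rho-unique []        σ ρ≡[]    = sym ρ≡[]
rho-unique γ@(_ ∷ _) σ (l , ps) =
  trans (cong (λ k → replicate k (length γ)) (sym l)) (sym (all-≡⇒replicate ps))

sum-replicate : ∀ k x → sum (replicate k x) ≡ k * x
sum-replicate zero    x = refl
sum-replicate (suc k) x = cong (x +_) (sum-replicate k x)

sum-rho : ∀ γ σ → sum (rho γ σ) ≡ length σ * length γ
sum-rho []        σ = sym (*-zeroʳ (length σ))
sum-rho γ@(_ ∷ _) σ = sum-replicate (length σ) (length γ)

-- Merging a copartition into one partition

-- The partition with parts length γ + s, for s in σ, followed by the conjugate of
-- γ without its largest part.  In the merge of a copartition the former parts
-- exceed length γ and the latter do not.
merge : List ℕ → List ℕ → List ℕ
merge γ σ = map (length γ +_) σ ++ conjTail γ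

sum-map-+ : ∀ m xs → sum (map (m +_) xs) ≡ length xs * m + sum xs
sum-map-+ m []       = refl
sum-map-+ m (x ∷ xs) = trans (cong (m + x +_) (sum-map-+ m xs))
  (solve 4 (λ m x a s → m :+ x :+ (a :+ s) := m :+ a :+ (x :+ s)) refl m x (length xs * m) (sum xs))
  where open +-*-Solver

-- The part length γ deleted from the conjugate of γ is the only size lost in
-- merging.
sum-copartition : ∀ {γ} σ → All (0 <_) γ →
                  sum γ + sum (rho γ σ) + sum σ ≡ length γ + sum (merge γ σ)
sum-copartition {γ} σ ps = begin
  sum γ + sum (rho γ σ) + sum σ
    ≡⟨ cong₂ (λ a b → a + b + sum σ) (sum-conjTail ps) (sum-rho γ σ) ⟩
  m + t + r + sum σ
    ≡⟨ solve 4 (λ m t r s → m :+ t :+ r :+ s := m :+ (r :+ s :+ t)) refl m t r (sum σ) ⟩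
  m + (r + sum σ + t)
    ≡⟨ cong (λ a → m + (a + t)) (sum-map-+ m σ) ⟨
  m + (sum (map (m +_) σ) + t)
    ≡⟨ cong (m +_) (sum-++ (map (m +_) σ) (conjTail γ)) ⟨
  m + sum (merge γ σ) ∎
  where
  open ≡-Reasoning
  open +-*-Solver
  m = length γ
  t = sum (conjTail γ)
  r = length σ * length γ

conjTail-≤ : ∀ γ → All (_≤ length γ) (conjTail γ)
conjTail-≤ γ = All.drop⁺ 1 (conj-≤-length γ)

shift-> : ∀ m {σ} → All (0 <_) σ → All (m <_) (map (m +_) σ)
shift-> m ps = All.map⁺ (All.map (m<m+n m) ps)

merge-partition : ∀ γ {σ} → IsPartition σ → IsPartition (merge γ σ)
merge-partition γ {σ} σp@(isPartition _ σ>0) = mkPartition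
  (AllPairs.++⁺
    (AllPairs.map⁺ (AllPairs.map (+-monoʳ-≤ (length γ)) (decreasing σp)))
    (AllPairs.drop⁺ 1 (conj-decreasing γ))
    (All.map (λ m<x → All.map (λ y≤m → ≤-trans y≤m (<⇒≤ m<x)) (conjTail-≤ γ)) σ>m))
  (All.++⁺ (All.map m<n⇒0<n σ>m) (All.drop⁺ 1 (conj-positive γ)))
  where
  σ>m : All (length γ <_) (map (length γ +_) σ)
  σ>m = shift-> (length γ) σ>0

-- Splitting a partition at a threshold

-- The parts of a list that are greater than m, and those that are at most m.
high low : ℕ → List ℕ → List ℕ
high m = filter (m <?_)
low  m = filter (_≤? m)

high-++ : ∀ {m xs ys} → All (m <_) xs → All (_≤ m) ys → high m (xs ++ ys) ≡ xs
high-++ {m} {xs} {ys} xs>m ys≤m = trans (filter-++ (m <?_) xs ys)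
  (trans (cong₂ _++_ (filter-all (m <?_) xs>m) (filter-none (m <?_) (All.map ≤⇒≯ ys≤m)))
         (++-identityʳ xs))

low-++ : ∀ {m xs ys} → All (m <_) xs → All (_≤ m) ys → low m (xs ++ ys) ≡ ys
low-++ {m} {xs} {ys} xs>m ys≤m = trans (filter-++ (_≤? m) xs ys)
  (cong₂ _++_ (filter-none (_≤? m) (All.map <⇒≱ xs>m)) (filter-all (_≤? m) ys≤m))

high++low : ∀ m {xs} → Decreasing xs → high m xs ++ low m xs ≡ xs
high++low m []                = refl
high++low m {x ∷ xs} (d ∷ ds) with m <? x
... | yes m<x = trans
  (cong₂ _++_ (filter-accept (m <?_) m<x) (filter-reject (_≤? m) (<⇒≱ m<x)))
  (cong (x ∷_) (high++low m ds))
... | no m≮x = cong₂ _++_ (high-++ [] all≤m) (low-++ [] all≤m)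
  where
  -- The list decreases, so from here on every part is low.
  all≤m : All (_≤ m) (x ∷ xs)
  all≤m = ≮⇒≥ m≮x ∷ All.map (λ y≤x → ≤-trans y≤x (≮⇒≥ m≮x)) d

-- The components γ and σ of the copartition obtained from μ when γ is to have
-- m parts; they invert merge.
splitγ splitσ : ℕ → List ℕ → List ℕ
splitγ m μ = conj (m ∷ low m μ)
splitσ m μ = map (_∸ m) (high m μ)

splitσ-partition : ∀ m {μ} → IsPartition μ → IsPartition (splitσ m μ)
splitσ-partition m {μ} μp = mkPartition
  (AllPairs.map⁺ (AllPairs.map (∸-monoˡ-≤ m) (AllPairs.filter⁺ (m <?_) (decreasing μp))))
  (All.map⁺ (All.map m<n⇒0<n∸m (All.all-filter (m <?_) μ)))

splitγ-merge : ∀ {γ σ} → IsPartition γ → IsPartition σ → splitγ (length γ) (merge γ σ) ≡ γ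
splitγ-merge {γ} {σ} γp (isPartition _ σ>0) = trans
  (cong (λ μ → conj (length γ ∷ μ)) (low-++ (shift-> (length γ) σ>0) (conjTail-≤ γ)))
  (conj-conjTail γp)
  where
  conj-conjTail : ∀ {γ} → IsPartition γ → conj (length γ ∷ conjTail γ) ≡ γ
  conj-conjTail {[]}        _                       = refl
  conj-conjTail {γ@(_ ∷ _)} γp@(isPartition _ γ>0) =
    trans (cong conj (sym (conj-∷ γ>0))) (conj-involutive (decreasing γp) γ>0)

splitσ-merge : ∀ γ {σ} → IsPartition σ → splitσ (length γ) (merge γ σ) ≡ σ
splitσ-merge γ {σ} (isPartition _ σ>0) = begin
  map (_∸ m) (high m (merge γ σ)) ≡⟨ cong (map (_∸ m)) (high-++ (shift-> m σ>0) (conjTail-≤ γ)) ⟩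
  map (_∸ m) (map (m +_) σ)       ≡⟨ map-∘ σ ⟨
  map (λ x → m + x ∸ m) σ         ≡⟨ map-id-local (All.universal (m+n∸m≡n m) σ) ⟩
  σ                               ∎
  where
  open ≡-Reasoning
  m = length γ

length-splitγ : ∀ m μ → length (splitγ m μ) ≡ m
length-splitγ m μ = length-conj (All.all-filter (_≤? m) μ)

conjTail-splitγ : ∀ m {μ} → IsPartition μ → conjTail (splitγ m μ) ≡ low m μ
-- For m = 0 no part of μ is at most m, and the added part 0 is ignored by conj.
conjTail-splitγ zero    {μ} (isPartition _ μ>0)
  rewrite filter-none (_≤? 0) (All.map <⇒≱ μ>0) = refl
conjTail-splitγ (suc m) {μ} μp@(isPartition _ μ>0) = cong (drop 1) (conj-involutive
  (All.all-filter (_≤? suc m) μ ∷ AllPairs.filter⁺ (_≤? suc m) (decreasing μp))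
  (s≤s z≤n ∷ All.filter⁺ (_≤? suc m) μ>0))

merge-split : ∀ m {μ} → IsPartition μ → merge (splitγ m μ) (splitσ m μ) ≡ μ
merge-split m {μ} μp = begin
  map (length (splitγ m μ) +_) (splitσ m μ) ++ conjTail (splitγ m μ)
    ≡⟨ cong₂ (λ l t → map (l +_) (splitσ m μ) ++ t) (length-splitγ m μ) (conjTail-splitγ m μp) ⟩
  map (m +_) (map (_∸ m) (high m μ)) ++ low m μ
    ≡⟨ cong (_++ low m μ) (map-∘ (high m μ)) ⟨
  map (λ x → m + (x ∸ m)) (high m μ) ++ low m μ
    ≡⟨ cong (_++ low m μ)
         (map-id-local (All.map (m+[n∸m]≡n ∘′ <⇒≤) (All.all-filter (m <?_) μ))) ⟩
  high m μ ++ low m μ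
    ≡⟨ high++low m (decreasing μp) ⟩
  μ ∎
  where open ≡-Reasoning

-- The inverse maps

-- Forgets ρ, which γ and σ determine.
toPartition : List ℕ × List ℕ × List ℕ → List ℕ
toPartition (γ , _ , σ) = merge γ σ

module _ (n : ℕ) where

  -- The number of parts of γ is the defect n ∸ sum μ.
  fromPartition : List ℕ → List ℕ × List ℕ × List ℕ
  fromPartition μ = γ , rho γ σ , σ
    where
    γ = splitγ (n ∸ sum μ) μ
    σ = splitσ (n ∸ sum μ) μ

  size-merge : ∀ {γ ρ σ} → IsCopartitionOf n (γ , ρ , σ) → length γ + sum (merge γ σ) ≡ n
  size-merge {γ} {σ = σ} (isCopartition (isPartition _ γ>0) _ _ c , s)
    with refl ← rho-unique γ σ c = trans (sym (sum-copartition σ γ>0)) s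

  toPartition-valid : ∀ {t} → IsCopartitionOf n t → IsPartitionUpTo n (toPartition t)
  toPartition-valid {γ , _ , _} c@(isCopartition _ _ σp _ , _) =
    _ , ≤-trans (m≤n+m _ (length γ)) (≤-reflexive (size-merge c))
      , isPartitionOf (merge-partition γ σp) refl

  fromPartition-valid : ∀ {μ} → IsPartitionUpTo n μ → IsCopartitionOf n (fromPartition μ)
  fromPartition-valid {μ} (_ , μ≤n , isPartitionOf μp refl) =
    isCopartition (conj-partition (m ∷ low m μ)) (rho-partition γ σ)
                  (splitσ-partition m μp) (rho-condition γ σ)
    , (begin
      sum γ + sum (rho γ σ) + sum σ ≡⟨ sum-copartition σ (conj-positive (m ∷ low m μ)) ⟩
      length γ + sum (merge γ σ)    ≡⟨ cong₂ _+_ (length-splitγ m μ) (cong sum (merge-split m μp)) ⟩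
      n ∸ sum μ + sum μ             ≡⟨ m∸n+n≡m μ≤n ⟩
      n                             ∎)
    where
    open ≡-Reasoning
    m = n ∸ sum μ
    γ = splitγ m μ
    σ = splitσ m μ

  number-of-parts : ∀ {γ ρ σ} → IsCopartitionOf n (γ , ρ , σ) → n ∸ sum (merge γ σ) ≡ length γ
  number-of-parts {γ} {σ = σ} c = trans (cong (_∸ sum (merge γ σ)) (sym (size-merge c)))
                                        (m+n∸n≡m (length γ) (sum (merge γ σ)))

  from-to : ∀ {t} → IsCopartitionOf n t → fromPartition (toPartition t) ≡ t
  from-to {γ , ρ , σ} c@(isCopartition γp _ σp ρc , _)
    rewrite number-of-parts c | splitγ-merge γp σp | splitσ-merge γ σp | rho-unique γ σ ρc = refl

  to-from : ∀ {μ} → IsPartitionUpTo n μ → toPartition (fromPartition μ) ≡ μ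
  to-from {μ} (_ , _ , isPartitionOf μp _) = merge-split (n ∸ sum μ) μp

theorem4p5 : ∀ (n : ℕ) → cp₁₁₁ n ≡ sum (map p (upTo (suc n)))
theorem4p5 n = trans
  (count-cong (copartitions n) (enumerateUpTo size-unique partitions n) toPartition (fromPartition n)
    (toPartition-valid n) (fromPartition-valid n) (from-to n) (to-from n))
  (count-enumerateUpTo size-unique partitions n)
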